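{- Let $x = x[1..n]$ be a nonempty string over an alphabet $\Sigma$ totally ordered by $\prec$, and let $\mathrm{ISA}$ be the inverse suffix array of $x$ with respect to $\prec$. Then for all $1 \le i \le j \le n$, the substring $x[i..j]$ is the longest Lyndon factor of $x$ starting at position $i$ (with respect to $\prec$) if and only if (a) for every $h$ with $i+1 \le h \le j$, $\mathrm{ISA}[i] < \mathrm{ISA}[h]$; and (b) either $j = n$ or $\mathrm{ISA}[j+1] < \mathrm{ISA}[i]$.
   Context: Strings are compared in the lexicographic order induced by $\prec$ (a proper prefix of a string is smaller than the string). A string is primitive if it is not of the form $u^e$ with $e>1$ an integer. A Lyndon word is a nonempty primitive string that is lexicographically least among all its rotations $vu$ (where the string is written $uv$ with $v$ nonempty). A Lyndon factor of $x$ is a substring of $x$ that is a Lyndon word. "Longest Lyndon factor" at $i$ means the longest Lyndon word of the form $x[i..k]$, $i \le k \le n$. The inverse suffix array satisfies: $\mathrm{ISA}[i] \in \{1,\dots,n\}$ is the rank of the suffix $x[i..n]$ in the lexicographic order among all nonempty suffixes of $x$; thus $x[i..n] \prec x[j..n]$ if and only if $\mathrm{ISA}[i] < \mathrm{ISA}[j]$. -}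

module Defs where

open import Level using (Level; _⊔_)
open import Data.Nat using (ℕ; suc; _∸_; _≤_; _<_)
open import Data.List using (List; []; _++_; take; drop; length; replicate; concat; filter; map; upTo)
open import Data.List.Relation.Binary.Lex.Strict using (Lex-<; Lex-≤; <-decidable)
open import Relation.Binary.Core using (Rel)
open import Relation.Binary.Structures using (IsStrictTotalOrder)
open import Relation.Binary.Definitions using (Decidable)
open import Relation.Binary.PropositionalEquality using (_≡_; _≢_)

-- Strings are lists; positions are natural numbers counted from 1.

infix 8 _[_⋯_]

-- The substring at positions i, …, j, both ends included.  It is meaningful
-- only for 1 ≤ i and j ≤ length x, and is empty if j < i.
_[_⋯_] : {a : Level} {A : Set a} → List A → ℕ → ℕ → List A
x [ i ⋯ j ] = take (suc j ∸ i) (drop (i ∸ 1) x)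

suffix : {a : Level} {A : Set a} → List A → ℕ → List A
suffix x i = x [ i ⋯ length x ]

infixr 8 _^ˢ_

_^ˢ_ : {a : Level} {A : Set a} → List A → ℕ → List A
u ^ˢ e = concat (replicate e u)

Primitive : {a : Level} {A : Set a} → List A → Set a
Primitive w = ∀ u e → 1 < e → w ≢ u ^ˢ e

record Lyndon {a ℓ : Level} {A : Set a} (_≺_ : Rel A ℓ) (w : List A) : Set (a ⊔ ℓ) where
  field
    isNonempty  : w ≢ []
    isPrimitive : Primitive w
    isLeast     : ∀ u v → v ≢ [] → w ≡ u ++ v → Lex-≤ _≡_ _≺_ w (v ++ u)

record LongestLyndonFactor {a ℓ : Level} {A : Set a} (_≺_ : Rel A ℓ)
                           (x : List A) (i j : ℕ) : Set (a ⊔ ℓ) where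
  field
    lyndon  : Lyndon _≺_ (x [ i ⋯ j ])
    longest : ∀ k → i ≤ k → k ≤ length x → Lyndon _≺_ (x [ i ⋯ k ]) →
              length (x [ i ⋯ k ]) ≤ length (x [ i ⋯ j ])

module _ {a ℓ : Level} {A : Set a} {_≺_ : Rel A ℓ}
         (sto : IsStrictTotalOrder _≡_ _≺_) where

  open IsStrictTotalOrder sto using (_≟_; _<?_)

  lex<? : Decidable (Lex-< _≡_ _≺_)
  lex<? = <-decidable _≟_ _<?_

  -- The rank, counted from 1, of the suffix at i: one more than the number of
  -- positions k in 1, …, n whose suffix is strictly smaller.
  ISA : List A → ℕ → ℕ
  ISA x i = suc (length (filter (λ k → lex<? (suffix x k) (suffix x i))
                                (map suc (upTo (length x)))))

{-# OPTIONS --safe #-}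

-- Write the suffix at i as w t with w = x[i..j].  Condition (a) says that w t is
-- smaller than v t for every nonempty proper suffix v of w, and (b) that t is
-- empty or smaller than w t.  A word is Lyndon iff it is smaller than each of its
-- nonempty proper suffixes.  As these are shorter than w, the comparison is decided
-- at a mismatch and survives appending t, so Lyndon words satisfy (a).  Conversely
-- (a) and (b) make w Lyndon: a suffix v of w = v y with w t ≺ v t would give
-- y t ≺ t ≺ w t, against (a).
-- If w is Lyndon but w t ≺ t, moving the end of w to the next position whose
-- suffix is smaller than w t (or to the end of x) gives a longer Lyndon factor.

module Submission where

open import Defs
open import Level using (Level)
open import Data.Nat using (ℕ; zero; suc; _+_; _∸_; _≤_; _<_; z≤n; s≤s; s≤s⁻¹; z<s)
open import Data.Nat.Properties
  using (≤-refl; ≤-trans; ≤-reflexive; ≤-total; ≤-<-trans; <-irrefl; <-asym; <⇒≤; ≤∧≢⇒<;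
         m+[n∸m]≡n; m+n∸m≡n; m≤n⇒m⊓n≡m; +-comm; +-cancelˡ-≡; <⇒≱;
         +-monoʳ-≤; +-monoʳ-<; ∸-monoˡ-≤; ∸-monoˡ-<; m<m+n; m<n⇒0<n∸m; m≤n⇒m<n∨m≡n; n∸n≡0)
open import Data.List
  using (List; []; _∷_; _++_; _∷ʳ_; [_]; length; take; drop; filter; map; upTo; initLast; _∷ʳ′_)
open import Data.List.Properties
  using (++-assoc; ++-identityʳ; ++-identityˡ-unique; ++-conicalˡ; ++-conicalʳ;
         length-++; length-++-≤ˡ; length-++-≤ʳ; length-++-comm; length-take; length-drop;
         take-all; take++drop≡id; drop-drop; ∷-injective; ∷ʳ-injective)
open import Data.List.Membership.Propositional using (_∈_)
open import Data.List.Membership.Propositional.Properties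
  using (∈-filter⁺; ∈-filter⁻; ∈-map⁺; ∈-upTo⁺)
open import Data.List.Relation.Binary.Lex.Strict
  using (Lex-<; Lex-≤; base; halt; this; next; xs≮[]; ≤-antisymmetric;
         <-isStrictTotalOrder)
  renaming (≤-reflexive to ⊑-reflexive)
open import Data.List.Relation.Binary.Pointwise using (Pointwise-≡⇒≡; ≡⇒Pointwise-≡)
open import Data.List.Relation.Binary.Sublist.Propositional using (⊆-refl)
open import Data.List.Relation.Binary.Sublist.Propositional.Properties
  using (filter⁺; length-mono-≤; to-≋)
open import Data.Product using (∃; ∃₂; _×_; _,_; proj₂)
open import Data.Sum using (_⊎_; inj₁; inj₂)
open import Function.Base using (_∘_)
open import Function.Bundles using (_⇔_; mk⇔)
open import Function.Construct.Composition using (_⇔-∘_)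
open import Data.Product.Function.NonDependent.Propositional using (_×-⇔_)
open import Relation.Binary.Core using (Rel)
open import Relation.Binary.Definitions using (Trichotomous; tri<; tri≈; tri>)
open import Relation.Binary.Structures using (IsStrictTotalOrder)
open import Relation.Binary.PropositionalEquality
  using (_≡_; _≢_; refl; sym; trans; cong; cong₂; subst; subst₂; module ≡-Reasoning)
open import Relation.Nullary using (¬_; contradiction)
open import Relation.Unary using (Pred; Decidable)

-- Factorisations of words, powers and commuting words.

module _ {a : Level} {A : Set a} where

  0<length : {u : List A} → u ≢ [] → 0 < length u
  0<length {[]}    u≢[] = contradiction refl u≢[]
  0<length {_ ∷ _} _    = z<s

  length-++-<ʳ : ∀ (v : List A) {u} → u ≢ [] → length v < length (u ++ v)
  length-++-<ʳ v {[]}    u≢[] = contradiction refl u≢[]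
  length-++-<ʳ v {_ ∷ u} _    = s≤s (length-++-≤ʳ v {u})

  length-++-<ˡ : ∀ (u : List A) {v} → v ≢ [] → length u < length (u ++ v)
  length-++-<ˡ u {v} v≢[] = subst (length u <_) (length-++-comm v u) (length-++-<ʳ u v≢[])

  ++-split : ∀ (u v : List A) {p q} → u ++ p ≡ v ++ q → length u ≤ length v →
             ∃ λ z → v ≡ u ++ z × p ≡ z ++ q
  ++-split []      v       eq _         = v , refl , eq
  ++-split (_ ∷ u) (_ ∷ v) eq (s≤s u≤v) with refl , eq′ ← ∷-injective eq
    with z , v≡uz , p≡zq ← ++-split u v eq′ u≤v = z , cong (_ ∷_) v≡uz , p≡zq

  take-length-++ : ∀ (u : List A) {v} → take (length u) (u ++ v) ≡ u
  take-length-++ []      = refl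
  take-length-++ (c ∷ u) = cong (c ∷_) (take-length-++ u)

  drop-length-++ : ∀ (u : List A) {v} → drop (length u) (u ++ v) ≡ v
  drop-length-++ []      = refl
  drop-length-++ (_ ∷ u) = drop-length-++ u

  -- Turns positions into factorisations. Here `i` counts dropped letters, hence the `suc` for
  -- positions counted from 1; the `take` inside `suffix` cuts nothing off.
  suffix-++ : ∀ (x : List A) i u r → drop i x ≡ u ++ r → suffix x (suc (i + length u)) ≡ r
  suffix-++ x i u r eq = begin
    take (length x ∸ (i + length u)) (drop (i + length u) x)
      ≡⟨ take-all _ _ (≤-reflexive (length-drop (i + length u) x)) ⟩
    drop (i + length u) x         ≡⟨ drop-drop i (length u) x ⟨
    drop (length u) (drop i x)    ≡⟨ cong (drop (length u)) eq ⟩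
    drop (length u) (u ++ r)      ≡⟨ drop-length-++ u ⟩
    r                             ∎
    where open ≡-Reasoning

  ^ˢ-+ : ∀ (z : List A) m n → z ^ˢ (m + n) ≡ z ^ˢ m ++ z ^ˢ n
  ^ˢ-+ z zero    n = refl
  ^ˢ-+ z (suc m) n = trans (cong (z ++_) (^ˢ-+ z m n)) (sym (++-assoc z _ _))

  -- Exponent 0 is allowed so that the empty word shares a root with every word, which settles the
  -- base cases below.
  CommonRoot : List A → List A → Set a
  CommonRoot u v = ∃ λ z → ∃₂ λ m n → u ≡ z ^ˢ m × v ≡ z ^ˢ n

  -- Euclid's algorithm on lengths: if `u` is the shorter word, then `v = u y = y u`, so `u` and `y`
  -- commute again, and a common root of theirs is one of `v`. The argument `k` of `go` bounds the
  -- total length and drives the recursion.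
  commute⇒commonRoot : ∀ (u v : List A) → u ++ v ≡ v ++ u → CommonRoot u v
  commute⇒commonRoot u v = go (length u + length v) u v ≤-refl
    where
    go : ∀ k u v → length u + length v ≤ k → u ++ v ≡ v ++ u → CommonRoot u v
    shorten : ∀ k u v → u ≢ [] → v ≢ [] → length u + length v ≤ suc k → u ++ v ≡ v ++ u →
              length u ≤ length v → CommonRoot u v

    go _ []      v       _ _ = v , 0 , 1 , refl , sym (++-identityʳ v)
    go _ (c ∷ u) []      _ _ = c ∷ u , 1 , 0 , sym (++-identityʳ (c ∷ u)) , refl
    go (suc k) u@(_ ∷ _) v@(_ ∷ _) l uv≡vu with ≤-total (length u) (length v)
    ... | inj₁ u≤v = shorten k u v (λ ()) (λ ()) l uv≡vu u≤v
    ... | inj₂ v≤u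
      with z , m , n , v≡zᵐ , u≡zⁿ ← shorten k v u (λ ()) (λ ())
             (≤-trans (≤-reflexive (+-comm (length v) _)) l) (sym uv≡vu) v≤u =
      z , n , m , u≡zⁿ , v≡zᵐ

    shorten k u v u≢[] v≢[] l uv≡vu u≤v
      with y , v≡uy , v≡yu ← ++-split u v uv≡vu u≤v
      with z , m , n , u≡zᵐ , y≡zⁿ ← go k u y
             (s≤s⁻¹ (≤-trans (+-monoʳ-< (length u)
                (subst (λ v → length y < length v) (sym v≡yu)
                  (length-++-<ˡ y u≢[]))) l))
             (trans (sym v≡uy) v≡yu) =
      z , m , m + n , u≡zᵐ ,
      trans v≡uy (trans (cong₂ _++_ u≡zᵐ y≡zⁿ) (sym (^ˢ-+ z m n)))

  -- Nonempty words have positive exponents over their common root, so the exponents add up to at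
  -- least 2.
  commute⇒¬primitive : ∀ {u v : List A} → u ≢ [] → v ≢ [] → u ++ v ≡ v ++ u →
                       ¬ Primitive (u ++ v)
  commute⇒¬primitive {u} {v} u≢[] v≢[] uv≡vu prim with commute⇒commonRoot u v uv≡vu
  ... | _ , zero  , _     , u≡[] , _    = u≢[] u≡[]
  ... | _ , suc _ , zero  , _    , v≡[] = v≢[] v≡[]
  ... | z , suc m , suc n , u≡   , v≡   =
    prim z (suc m + suc n) (s≤s (≤-trans (s≤s z≤n) (≤-reflexive (+-comm (suc n) m))))
      (trans (cong₂ _++_ u≡ v≡) (sym (^ˢ-+ z (suc m) (suc n))))

-- Comparing the sizes of filtered lists.

module _ {a p q : Level} {A : Set a} {P : Pred A p} {Q : Pred A q}
         (P? : Decidable P) (Q? : Decidable Q) where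

  -- The first filtered list is a sublist of the second. With equal lengths the two would coincide,
  -- and `x` would satisfy `P`.
  length-filter-mono-< : (∀ {y} → P y → Q y) → ∀ {x xs} → x ∈ xs → ¬ P x → Q x →
                         length (filter P? xs) < length (filter Q? xs)
  length-filter-mono-< P⇒Q {x} {xs} x∈xs ¬Px Qx = ≤∧≢⇒< (length-mono-≤ P⊆Q) (λ eq →
    ¬Px (proj₂ (∈-filter⁻ P? {xs = xs}
      (subst (x ∈_) (sym (Pointwise-≡⇒≡ (to-≋ eq P⊆Q))) (∈-filter⁺ Q? x∈xs Qx)))))
    where P⊆Q = filter⁺ P? Q? (λ { refl → P⇒Q }) (⊆-refl {x = xs})

-- Lexicographic order.

module _ {a ℓ : Level} {A : Set a} {_≺_ : Rel A ℓ} (sto : IsStrictTotalOrder _≡_ _≺_) where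

  private
    module ≺ = IsStrictTotalOrder sto
    module ⊏ = IsStrictTotalOrder (<-isStrictTotalOrder sto)

  infix 4 _⊏_ _⊑_ _⋘_

  _⊏_ _⊑_ _⋘_ : Rel (List A) _
  _⊏_ = Lex-< _≡_ _≺_
  _⊑_ = Lex-≤ _≡_ _≺_

  -- u and v differ at some position, and u is the smaller one there.
  u ⋘ v = ∀ p q → u ++ p ⊏ v ++ q

  ⊏-irrefl : ∀ {u} → ¬ u ⊏ u
  ⊏-irrefl = ⊏.irrefl (≡⇒Pointwise-≡ refl)

  ⊏-compare : Trichotomous _≡_ _⊏_
  ⊏-compare u v with ⊏.compare u v
  ... | tri< u⊏v u≢v v⊏̸u = tri< u⊏v (u≢v ∘ ≡⇒Pointwise-≡) v⊏̸u
  ... | tri≈ u⊏̸v u≡v v⊏̸u = tri≈ u⊏̸v (Pointwise-≡⇒≡ u≡v) v⊏̸u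
  ... | tri> u⊏̸v u≢v v⊏u = tri> u⊏̸v (u≢v ∘ ≡⇒Pointwise-≡) v⊏u

  ⊏⇒⊑ : ∀ {u v} → u ⊏ v → u ⊑ v
  ⊏⇒⊑ halt           = halt
  ⊏⇒⊑ (this c≺d)     = this c≺d
  ⊏⇒⊑ (next c≡d u⊏v) = next c≡d (⊏⇒⊑ u⊏v)

  ⊑-antisym : ∀ {u v} → u ⊑ v → v ⊑ u → u ≡ v
  ⊑-antisym u⊑v v⊑u = Pointwise-≡⇒≡ (≤-antisymmetric sym ≺.irrefl ≺.asym u⊑v v⊑u)

  ⊑⇒⊐̸ : ∀ {u v} → u ⊑ v → ¬ v ⊏ u
  ⊑⇒⊐̸ u⊑v v⊏u with refl ← ⊑-antisym u⊑v (⊏⇒⊑ v⊏u) = ⊏-irrefl v⊏u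

  ⊏-++⁺ʳ : ∀ {u v} w → u ⊏ v → u ⊏ v ++ w
  ⊏-++⁺ʳ w halt           = halt
  ⊏-++⁺ʳ w (this c≺d)     = this c≺d
  ⊏-++⁺ʳ w (next c≡d u⊏v) = next c≡d (⊏-++⁺ʳ w u⊏v)

  ⊏-cancelˡ : ∀ w {u v} → w ++ u ⊏ w ++ v → u ⊏ v
  ⊏-cancelˡ []      u⊏v             = u⊏v
  ⊏-cancelˡ (c ∷ w) (this c≺c)      = contradiction c≺c (≺.irrefl refl)
  ⊏-cancelˡ (c ∷ w) (next _ wu⊏wv)  = ⊏-cancelˡ w wu⊏wv

  ⊑-cancelˡ : ∀ w {u v} → w ++ u ⊑ w ++ v → u ⊑ v
  ⊑-cancelˡ []      u⊑v             = u⊑v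
  ⊑-cancelˡ (c ∷ w) (this c≺c)      = contradiction c≺c (≺.irrefl refl)
  ⊑-cancelˡ (c ∷ w) (next _ wu⊑wv)  = ⊑-cancelˡ w wu⊑wv

  ⊑-prefix : ∀ u v {p q} → length u ≡ length v → u ++ p ⊑ v ++ q → u ⊑ v
  ⊑-prefix []      []      _  _               = base _
  ⊑-prefix (_ ∷ _) (_ ∷ _) _  (this c≺d)      = this c≺d
  ⊑-prefix (_ ∷ u) (_ ∷ v) eq (next c≡d up⊑vq) =
    next c≡d (⊑-prefix u v (cong (_∸ 1) eq) up⊑vq)

  -- Separates the two ways of being smaller: a mismatch survives any extension to the right,
  -- whereas a mere prefix relation need not and has to be refuted or cancelled.
  ⊏⇒prefix⊎⋘ : ∀ {u v} → u ⊏ v → (∃ λ y → y ≢ [] × v ≡ u ++ y) ⊎ u ⋘ v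
  ⊏⇒prefix⊎⋘ halt       = inj₁ (_ , (λ ()) , refl)
  ⊏⇒prefix⊎⋘ (this c≺d) = inj₂ (λ _ _ → this c≺d)
  ⊏⇒prefix⊎⋘ (next refl u⊏v) with ⊏⇒prefix⊎⋘ u⊏v
  ... | inj₁ (y , y≢[] , refl) = inj₁ (y , y≢[] , refl)
  ... | inj₂ u⋘v               = inj₂ (λ p q → next refl (u⋘v p q))

  -- Lyndon words as words below their proper suffixes.

  BelowProperSuffixes : List A → Set _
  BelowProperSuffixes w = ∀ u v → u ≢ [] → v ≢ [] → w ≡ u ++ v → w ⊏ v

  -- Cancelling the copies of `u` one by one leaves a comparison with the empty word on the right.
  ^ˢ-⊏̸ : ∀ u n → ¬ u ^ˢ suc n ⊏ u ^ˢ n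
  ^ˢ-⊏̸ u zero    = xs≮[]
  ^ˢ-⊏̸ u (suc n) = ^ˢ-⊏̸ u n ∘ ⊏-cancelˡ u

  -- Were `w` a power of `u` with exponent above 1, removing one copy of `u` would give a proper
  -- suffix that is also a prefix, hence not above `w`. For rotations, `w ⊏ v` stays true when `u`
  -- is appended on the right-hand side.
  belowProperSuffixes⇒lyndon : ∀ {w} → w ≢ [] → BelowProperSuffixes w → Lyndon _≺_ w
  belowProperSuffixes⇒lyndon {w} w≢[] below = record
    { isNonempty = w≢[] ; isPrimitive = isPrim ; isLeast = least }
    where
    ^ˢ-nonempty : ∀ {u} n → w ≡ u ^ˢ suc n → u ≢ []
    ^ˢ-nonempty zero    w≡[] refl = w≢[] w≡[]
    ^ˢ-nonempty (suc n) w≡   refl = ^ˢ-nonempty n w≡ refl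

    isPrim : Primitive w
    isPrim _ zero          ()
    isPrim _ (suc zero)    (s≤s ())
    isPrim u (suc (suc n)) _ refl =
      ^ˢ-⊏̸ u (suc n) (below u (u ^ˢ suc n) u≢[] (u≢[] ∘ ++-conicalˡ u _) refl)
      where u≢[] = ^ˢ-nonempty (suc n) refl

    least : ∀ u v → v ≢ [] → w ≡ u ++ v → w ⊑ v ++ u
    least []      v _    refl = ⊑-reflexive _≡_ _≺_ (≡⇒Pointwise-≡ (sym (++-identityʳ v)))
    least (c ∷ u) v v≢[] eq   = ⊏⇒⊑ (⊏-++⁺ʳ (c ∷ u) (below (c ∷ u) v (λ ()) v≢[] eq))

  -- Suppose `v ⊏ w`. A mismatch would make the rotation `v u` smaller than `w`; otherwise `v` is a
  -- prefix of `w`, and `u` and `v` turn out to commute, against primitivity.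
  lyndon⇒belowProperSuffixes : ∀ {w} → Lyndon _≺_ w → BelowProperSuffixes w
  lyndon⇒belowProperSuffixes {w} lyn u v u≢[] v≢[] refl with ⊏-compare w v
  ... | tri< w⊏v _ _  = w⊏v
  ... | tri≈ _ w≡v _  = contradiction (++-identityˡ-unique u (sym w≡v)) u≢[]
  ... | tri> _ _ v⊏w with ⊏⇒prefix⊎⋘ v⊏w
  ...   | inj₂ v⋘w = contradiction (subst (v ++ u ⊏_) (++-identityʳ w) (v⋘w u []))
                       (⊑⇒⊐̸ (Lyndon.isLeast lyn u v v≢[] refl))
  -- Here w = u v = v y; minimality among the rotations v u and y v forces y = u.
  ...   | inj₁ (y , y≢[] , uv≡vy) =
    contradiction (Lyndon.isPrimitive lyn) (commute⇒¬primitive u≢[] v≢[] uv≡vu)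
    where
    |u|≡|y| : length u ≡ length y
    |u|≡|y| = +-cancelˡ-≡ (length v) _ _ (trans (sym (length-++ v))
      (trans (length-++-comm v u) (trans (cong length uv≡vy) (length-++ v))))
    u⊑y : u ⊑ y
    u⊑y = ⊑-prefix u y |u|≡|y| (Lyndon.isLeast lyn v y y≢[] uv≡vy)
    y⊑u : y ⊑ u
    y⊑u = ⊑-cancelˡ v (subst (_⊑ v ++ u) uv≡vy (Lyndon.isLeast lyn u v v≢[] refl))
    uv≡vu : u ++ v ≡ v ++ u
    uv≡vu = trans uv≡vy (cong (v ++_) (⊑-antisym y⊑u u⊑y))

  -- The longest Lyndon prefix of a word `w ++ t`.

  module _ (w t : List A) where

    -- Condition (a) without positions: the `h` from `i+1` to `j` are the starts of the suffixes
    -- `v ++ t`.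
    BelowInnerSuffixes : Set _
    BelowInnerSuffixes = ∀ u v → u ≢ [] → v ≢ [] → w ≡ u ++ v → w ++ t ⊏ v ++ t

    -- Condition (b): `t` is the suffix at `j+1`, empty exactly when `j = n`.
    AboveNextSuffix : Set _
    AboveNextSuffix = t ≡ [] ⊎ t ⊏ w ++ t

    LongestLyndonPrefix : Set _
    LongestLyndonPrefix = Lyndon _≺_ w ×
      (∀ v r → w ++ t ≡ v ++ r → Lyndon _≺_ v → length v ≤ length w)

  -- The inequality `w ⊏ v` must come from a mismatch, since `w` is too long to be a prefix of `v`.
  lyndon⇒belowInnerSuffixes : ∀ {w} t → Lyndon _≺_ w → BelowInnerSuffixes w t
  lyndon⇒belowInnerSuffixes {w} t lyn u v u≢[] v≢[] refl
    with ⊏⇒prefix⊎⋘ (lyndon⇒belowProperSuffixes lyn u v u≢[] v≢[] refl)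
  ... | inj₂ w⋘v = w⋘v t t
  ... | inj₁ (y , _ , v≡wy) = contradiction
    (≤-trans (length-++-≤ˡ (u ++ v)) (≤-reflexive (sym (cong length v≡wy))))
    (<⇒≱ (length-++-<ʳ v u≢[]))

  belowInnerSuffixes⇒belowProperSuffixes : ∀ {w t} → BelowInnerSuffixes w t →
    AboveNextSuffix w t → BelowProperSuffixes w
  belowInnerSuffixes⇒belowProperSuffixes {w} {t} below above u v u≢[] v≢[] w≡uv
    with ⊏-compare w v
  ... | tri< w⊏v _ _ = w⊏v
  ... | tri≈ _ refl _ = contradiction (++-identityˡ-unique u w≡uv) u≢[]
  ... | tri> _ _ v⊏w with ⊏⇒prefix⊎⋘ v⊏w
  ...   | inj₂ v⋘w = contradiction (v⋘w t t) (⊏.asym (below u v u≢[] v≢[] w≡uv))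
  ...   | inj₁ (y , y≢[] , w≡vy) = contradiction yt⊏t (yt⊏̸t above)
    where
    yt⊏t : y ++ t ⊏ t
    yt⊏t = ⊏-cancelˡ v (subst (_⊏ v ++ t) (trans (cong (_++ t) w≡vy) (++-assoc v y t))
             (below u v u≢[] v≢[] w≡uv))
    yt⊏̸t : AboveNextSuffix w t → ¬ y ++ t ⊏ t
    yt⊏̸t (inj₁ refl) = xs≮[]
    -- `y` is a proper suffix of `w` too, so (a) applies to it and gives `t ⊏ w ++ t ⊏ y ++ t`.
    yt⊏̸t (inj₂ t⊏wt) = ⊏.asym (⊏.trans t⊏wt (below v y v≢[] y≢[] w≡vy))

  belowInnerSuffixes⇒lyndon : ∀ {w t} → w ≢ [] → BelowInnerSuffixes w t →
    AboveNextSuffix w t → Lyndon _≺_ w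
  belowInnerSuffixes⇒lyndon w≢[] below above =
    belowProperSuffixes⇒lyndon w≢[] (belowInnerSuffixes⇒belowProperSuffixes below above)

  -- Dropping the last letter of a proper suffix of `w ∷ʳ c` leaves either a proper suffix of `w`,
  -- covered by `below`, or the empty word; then the suffix is `c` alone, covered by `wct⊏ct`.
  belowInnerSuffixes-∷ʳ : ∀ w c t → BelowInnerSuffixes w (c ∷ t) → w ++ c ∷ t ⊏ c ∷ t →
    BelowInnerSuffixes (w ∷ʳ c) t
  belowInnerSuffixes-∷ʳ w c t below wct⊏ct u v u≢[] v≢[] wc≡uv with initLast v
  ... | []       = contradiction refl v≢[]
  ... | [] ∷ʳ′ d
    with refl ← proj₂ (∷ʳ-injective w u wc≡uv) =
    subst (_⊏ d ∷ t) (sym (++-assoc w [ d ] t)) wct⊏ct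
  ... | v′@(_ ∷ _) ∷ʳ′ d
    with w≡uv′ , refl ← ∷ʳ-injective w (u ++ v′) (trans wc≡uv (sym (++-assoc u v′ [ d ]))) =
    subst₂ _⊏_ (sym (++-assoc w [ d ] t)) (sym (++-assoc v′ [ d ] t))
      (below u v′ u≢[] (λ ()) w≡uv′)

  -- Absorbs letters into `w` as long as the suffix that follows is larger, which preserves
  -- `BelowInnerSuffixes`, and stops at a smaller suffix or at the end. The recursion is structural
  -- in `t`.
  nextSmallerSuffix : ∀ w c t → w ≢ [] → BelowInnerSuffixes w (c ∷ t) → w ++ c ∷ t ⊏ c ∷ t →
    ∃₂ λ v r → w ++ c ∷ t ≡ v ++ r × length w < length v ×
               BelowInnerSuffixes v r × AboveNextSuffix v r
  nextSmallerSuffix w c t w≢[] below wct⊏ct = result t refl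
    where
    s≡ : w ++ c ∷ t ≡ (w ∷ʳ c) ++ t
    s≡ = sym (++-assoc w [ c ] t)
    |w|<|wc| : length w < length (w ∷ʳ c)
    |w|<|wc| = length-++-<ˡ w λ ()
    below′ = belowInnerSuffixes-∷ʳ w c t below wct⊏ct
    result : ∀ r → t ≡ r → ∃₂ λ v r → w ++ c ∷ t ≡ v ++ r × length w < length v ×
               BelowInnerSuffixes v r × AboveNextSuffix v r
    result []      t≡[] = w ∷ʳ c , t , s≡ , |w|<|wc| , below′ , inj₁ t≡[]
    result (d ∷ r) refl with ⊏-compare t ((w ∷ʳ c) ++ t)
    ... | tri< t⊏ _ _ = w ∷ʳ c , t , s≡ , |w|<|wc| , below′ , inj₂ t⊏
    ... | tri≈ _ eq _ = contradiction (++-conicalʳ w [ c ] (++-identityˡ-unique (w ∷ʳ c) eq)) λ ()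
    ... | tri> _ _ ⊏t
      with v , r′ , eq , lt , rest ← nextSmallerSuffix (w ∷ʳ c) d r
             (λ eq → contradiction (++-conicalʳ w [ c ] eq) λ ()) below′ ⊏t =
      v , r′ , trans s≡ eq , ≤-trans |w|<|wc| (<⇒≤ lt) , rest

  longestLyndonPrefix⇔ : ∀ w t → w ≢ [] →
    LongestLyndonPrefix w t ⇔ (BelowInnerSuffixes w t × AboveNextSuffix w t)
  longestLyndonPrefix⇔ w t w≢[] = mk⇔ to from
    where
    to : LongestLyndonPrefix w t → BelowInnerSuffixes w t × AboveNextSuffix w t
    to (lyn , longest) = below , above t refl
      where
      below = lyndon⇒belowInnerSuffixes t lyn
      above : ∀ r → t ≡ r → AboveNextSuffix w t
      above []      t≡[] = inj₁ t≡[]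
      above (c ∷ r) refl with ⊏-compare t (w ++ t)
      ... | tri< t⊏wt _ _ = inj₂ t⊏wt
      ... | tri≈ _ eq _   = contradiction (++-identityˡ-unique w eq) w≢[]
      -- Failure of (b) lets the scan find a Lyndon prefix longer than `w`, against `longest`.
      ... | tri> _ _ wt⊏t
        with v , r′ , eq , w<v , below′ , above′ ← nextSmallerSuffix w c r w≢[] below wt⊏t =
        contradiction (≤-<-trans (longest v r′ eq (belowInnerSuffixes⇒lyndon v≢[] below′ above′)) w<v)
          (<-irrefl refl)
        where
        v≢[] : v ≢ []
        v≢[] v≡[] = <⇒≱ w<v (subst (λ z → length z ≤ length w) (sym v≡[]) z≤n)

    from : BelowInnerSuffixes w t × AboveNextSuffix w t → LongestLyndonPrefix w t
    from (below , above) = belowInnerSuffixes⇒lyndon w≢[] below above , longest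
      where
      longest : ∀ v r → w ++ t ≡ v ++ r → Lyndon _≺_ v → length v ≤ length w
      longest v r eq lyn with ≤-total (length v) (length w)
      ... | inj₁ v≤w = v≤w
      ... | inj₂ w≤v with ++-split w v eq w≤v
      ...   | []        , v≡w , _    = ≤-reflexive (cong length (trans v≡w (++-identityʳ w)))
      -- Here `p` is a proper suffix of the longer Lyndon word `v = w p`, so
      -- `w ++ t = v ++ r ⊏ p ++ r = t`, against (b).
      ...   | p@(_ ∷ _) , v≡wp , t≡pr = contradiction wt⊏t (wt⊏̸t above)
        where
        wt⊏t : w ++ t ⊏ t
        wt⊏t = subst₂ _⊏_ (sym eq) (sym t≡pr)
                 (lyndon⇒belowInnerSuffixes r lyn w p w≢[] (λ ()) v≡wp)
        wt⊏̸t : AboveNextSuffix w t → ¬ w ++ t ⊏ t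
        wt⊏̸t (inj₁ refl) = xs≮[]
        wt⊏̸t (inj₂ t⊏wt) = ⊏.asym t⊏wt

  -- Ranks and the order of suffixes.

  ISA-mono : ∀ x p q → 1 ≤ p → p ≤ length x → suffix x p ⊏ suffix x q → ISA sto x p < ISA sto x q
  ISA-mono x (suc p) q _ p<n p⊏q =
    -- By transitivity every position counted for `suc p` is counted for `q`; `suc p` itself is
    -- counted for `q` only.
    s≤s (length-filter-mono-< _ _ (λ k⊏p → ⊏.trans k⊏p p⊏q) (∈-map⁺ suc (∈-upTo⁺ p<n)) ⊏-irrefl p⊏q)

  -- The rank depends on a position only through its suffix, so equal suffixes have equal ranks; the
  -- reverse order is excluded by `ISA-mono`.
  ISA-reflect : ∀ x p q → 1 ≤ q → q ≤ length x → ISA sto x p < ISA sto x q → suffix x p ⊏ suffix x q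
  ISA-reflect x p q 1≤q q≤n lt with ⊏-compare (suffix x p) (suffix x q)
  ... | tri< p⊏q _ _ = p⊏q
  ... | tri≈ _ eq _  = contradiction lt (<-irrefl (cong (λ s → suc (length (filter
                         (λ k → lex<? sto (suffix x k) s) (map suc (upTo (length x)))))) eq))
  ... | tri> _ _ q⊏p = contradiction lt (<-asym (ISA-mono x q p 1≤q q≤n q⊏p))

  -- From positions in `x` to factorisations of a suffix.

  module _ (x : List A) {i j : ℕ} (i<j : i < j) (j≤n : j ≤ length x) where

    private
      n = length x
      s = drop i x
      -- The start position is `suc i`, so `x [ suc i ⋯ j ]` computes to `w` and needs no transport.
      w = take (j ∸ i) s
      t = drop (j ∸ i) s

      s≡wt : s ≡ w ++ t
      s≡wt = sym (take++drop≡id (j ∸ i) s)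

      i≤n : i ≤ n
      i≤n = ≤-trans (<⇒≤ i<j) j≤n

      |w|≡ : length w ≡ j ∸ i
      |w|≡ = trans (length-take (j ∸ i) s) (m≤n⇒m⊓n≡m
        (≤-trans (∸-monoˡ-≤ i j≤n) (≤-reflexive (sym (length-drop i x)))))

      i+|w|≡j : i + length w ≡ j
      i+|w|≡j = trans (cong (i +_) |w|≡) (m+[n∸m]≡n (<⇒≤ i<j))

      w≢[] : w ≢ []
      w≢[] w≡[] = <-irrefl (trans (sym (cong length w≡[])) |w|≡) (m<n⇒0<n∸m i<j)

      suffix-i : suffix x (suc i) ≡ w ++ t
      suffix-i = trans (take-all _ _ (≤-reflexive (length-drop i x))) s≡wt

      suffix-j : suffix x (suc j) ≡ t
      suffix-j = subst (λ k → suffix x (suc k) ≡ t) i+|w|≡j (suffix-++ x i w t s≡wt)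

      suffix-inner : ∀ u v → w ≡ u ++ v → suffix x (suc (i + length u)) ≡ v ++ t
      suffix-inner u v w≡uv =
        suffix-++ x i u (v ++ t) (trans s≡wt (trans (cong (_++ t) w≡uv) (++-assoc u v t)))

    longestLyndonFactor⇔prefix : LongestLyndonFactor _≺_ x (suc i) j ⇔ LongestLyndonPrefix w t
    longestLyndonFactor⇔prefix = mk⇔ to from
      where
      to : LongestLyndonFactor _≺_ x (suc i) j → LongestLyndonPrefix w t
      to llf = LongestLyndonFactor.lyndon llf , longest
        where
        longest : ∀ v r → w ++ t ≡ v ++ r → Lyndon _≺_ v → length v ≤ length w
        longest v r wt≡vr lyn = subst (λ z → length z ≤ length w) v≡
          -- A prefix `v` of the suffix at `suc i` ends at position `i + length v`.
          (LongestLyndonFactor.longest llf (i + length v)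
            (m<m+n i (0<length (Lyndon.isNonempty lyn)))
            (≤-trans (+-monoʳ-≤ i |v|≤) (≤-reflexive (m+[n∸m]≡n i≤n)))
            (subst (Lyndon _≺_) (sym v≡) lyn))
          where
          s≡vr = trans s≡wt wt≡vr
          v≡ : take (i + length v ∸ i) s ≡ v
          v≡ = trans (cong₂ take (m+n∸m≡n i (length v)) s≡vr) (take-length-++ v)
          |v|≤ : length v ≤ n ∸ i
          |v|≤ = ≤-trans (length-++-≤ˡ v)
            (≤-reflexive (trans (cong length (sym s≡vr)) (length-drop i x)))

      from : LongestLyndonPrefix w t → LongestLyndonFactor _≺_ x (suc i) j
      from (lyn , longest) = record
        { lyndon  = lyn
        ; longest = λ k _ _ → longest (take (k ∸ i) s) (drop (k ∸ i) s)
                      (trans (sym s≡wt) (sym (take++drop≡id (k ∸ i) s)))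
        }

    belowInnerSuffixes⇔ISA : BelowInnerSuffixes w t ⇔
      (∀ h → suc (suc i) ≤ h → h ≤ j → ISA sto x (suc i) < ISA sto x h)
    belowInnerSuffixes⇔ISA = mk⇔ to from
      where
      to : BelowInnerSuffixes w t →
           ∀ h → suc (suc i) ≤ h → h ≤ j → ISA sto x (suc i) < ISA sto x h
      to below (suc h) (s≤s i<h) h<j = ISA-mono x (suc i) (suc h) (s≤s z≤n) (≤-trans i<j j≤n)
        (subst₂ _⊏_ (sym suffix-i)
          (trans (sym (suffix-inner u v w≡uv)) (cong (suffix x ∘ suc) i+|u|≡h))
          (below u v u≢[] v≢[] w≡uv))
        where
        -- The position is now `suc h`, so `h ∸ i` letters of `w` precede it; `i < h < j` makes both
        -- parts nonempty.
        u = take (h ∸ i) w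
        v = drop (h ∸ i) w
        w≡uv : w ≡ u ++ v
        w≡uv = sym (take++drop≡id (h ∸ i) w)
        h∸i<|w| : h ∸ i < length w
        h∸i<|w| = subst (h ∸ i <_) (sym |w|≡) (∸-monoˡ-< h<j (<⇒≤ i<h))
        |u|≡ : length u ≡ h ∸ i
        |u|≡ = trans (length-take (h ∸ i) w) (m≤n⇒m⊓n≡m (<⇒≤ h∸i<|w|))
        i+|u|≡h : i + length u ≡ h
        i+|u|≡h = trans (cong (i +_) |u|≡) (m+[n∸m]≡n (<⇒≤ i<h))
        u≢[] : u ≢ []
        u≢[] u≡[] = <-irrefl (trans (sym (cong length u≡[])) |u|≡) (m<n⇒0<n∸m i<h)
        v≢[] : v ≢ []
        v≢[] v≡[] = <-irrefl (trans (sym (cong length v≡[])) (length-drop (h ∸ i) w))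
                      (m<n⇒0<n∸m h∸i<|w|)

      from : (∀ h → suc (suc i) ≤ h → h ≤ j → ISA sto x (suc i) < ISA sto x h) →
             BelowInnerSuffixes w t
      from cond u v u≢[] v≢[] w≡uv = subst₂ _⊏_ suffix-i (suffix-inner u v w≡uv)
        (ISA-reflect x (suc i) h (s≤s z≤n) (≤-trans h≤j j≤n)
          (cond h (s≤s (m<m+n i (0<length u≢[]))) h≤j))
        where
        h = suc (i + length u)
        h≤j : h ≤ j
        h≤j = subst (h ≤_) i+|w|≡j (+-monoʳ-< i
          (subst (λ z → length u < length z) (sym w≡uv) (length-++-<ˡ u v≢[])))

    aboveNextSuffix⇔ISA : AboveNextSuffix w t ⇔
      (j ≡ n ⊎ ISA sto x (suc j) < ISA sto x (suc i))
    aboveNextSuffix⇔ISA = mk⇔ to from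
      where
      |t|≡ : length t ≡ n ∸ j
      |t|≡ = trans (cong length (trans (drop-drop i (j ∸ i) x)
        (cong (λ k → drop k x) (m+[n∸m]≡n (<⇒≤ i<j))))) (length-drop j x)

      to : AboveNextSuffix w t → j ≡ n ⊎ ISA sto x (suc j) < ISA sto x (suc i)
      -- `ISA-mono` demands that `suc j` be a position of `x`, hence the split on `j < n`; at
      -- `j = n` the left alternative holds.
      to above with m≤n⇒m<n∨m≡n j≤n | above
      ... | inj₂ j≡n | _          = inj₁ j≡n
      ... | inj₁ j<n | inj₁ t≡[]  =
        contradiction (m<n⇒0<n∸m j<n) (<-irrefl (trans (sym (cong length t≡[])) |t|≡))
      ... | inj₁ j<n | inj₂ t⊏wt  = inj₂ (ISA-mono x (suc j) (suc i) (s≤s z≤n) j<n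
        (subst₂ _⊏_ (sym suffix-j) (sym suffix-i) t⊏wt))

      from : j ≡ n ⊎ ISA sto x (suc j) < ISA sto x (suc i) → AboveNextSuffix w t
      from (inj₁ j≡n) = inj₁ (length≡0⇒[] (trans |t|≡ (trans (cong (n ∸_) j≡n) (n∸n≡0 n))))
        where
        length≡0⇒[] : {z : List A} → length z ≡ 0 → z ≡ []
        length≡0⇒[] {[]} _ = refl
      -- The range check in `ISA-reflect` concerns its second position, here `suc i`, so `suc j` may
      -- lie one past the end of `x`.
      from (inj₂ lt) = inj₂ (subst₂ _⊏_ suffix-j suffix-i
        (ISA-reflect x (suc j) (suc i) (s≤s z≤n) (≤-trans i<j j≤n) lt))

    longestLyndonFactor⇔ISA : LongestLyndonFactor _≺_ x (suc i) j ⇔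
      ((∀ h → suc (suc i) ≤ h → h ≤ j → ISA sto x (suc i) < ISA sto x h) ×
       (j ≡ n ⊎ ISA sto x (suc j) < ISA sto x (suc i)))
    longestLyndonFactor⇔ISA =
      (belowInnerSuffixes⇔ISA ×-⇔ aboveNextSuffix⇔ISA) ⇔-∘
      (longestLyndonPrefix⇔ w t w≢[] ⇔-∘ longestLyndonFactor⇔prefix)

theorem12 : {a ℓ : Level} {A : Set a} {_≺_ : Rel A ℓ}
    (sto : IsStrictTotalOrder _≡_ _≺_) (x : List A) → x ≢ [] →
    (i j : ℕ) → 1 ≤ i → i ≤ j → j ≤ length x →
    LongestLyndonFactor _≺_ x i j ⇔
    ((∀ h → suc i ≤ h → h ≤ j → ISA sto x i < ISA sto x h) ×
    (j ≡ length x ⊎ ISA sto x (suc j) < ISA sto x i))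
theorem12 sto x _ (suc i) j _ i<j j≤n = longestLyndonFactor⇔ISA sto x i<j j≤n
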